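{- Let $G$ be a finite simple connected graph of order $n$ (that is, $|V(G)|=n$). Then for every positive integer $k\leq n$, $$\beta^{k}_S(G)\geq n-k-1.$$
   Context: For a finite simple graph $G$ and $v\in V(G)$, let $E_G(v)$ denote the set of all edges of $G$ incident with $v$. For a function $f:E(G)\to\{ -1,1\}$ and $S\subseteq E(G)$, write $f(S)=\sum_{e\in S}f(e)$ (so $f(\emptyset)=0$). A signed $k$-submatching of $G$ is a function $f:E(G)\to\{ -1,1\}$ such that $f(E_G(v))\leq 1$ holds for at least $k$ vertices $v\in V(G)$. The signed $k$-submatching number $\beta_S^k(G)$ is the maximum of $f(E(G))$ taken over all signed $k$-submatchings $f$ of $G$. -}

module Defs where

open import Level using (0ℓ)
open import Data.Bool.Base using (true; false; if_then_else_)
open import Data.Fin.Base using (Fin; zero; suc)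
open import Data.Fin.Properties using (_≟_; _<?_)
open import Data.Fin.Subset using (Subset; ⊤)
open import Data.Integer.Base as ℤ using (ℤ; 0ℤ; 1ℤ; -1ℤ; _◃_)
import Data.Integer.Properties as ℤ
open import Algebra.Properties.CommutativeMonoid.Sum ℤ.+-0-commutativeMonoid using (sum; sum-cong-≗)
open import Data.List.Base as List using (List; []; _∷_)
open import Data.List.Extrema ℤ.≤-totalOrder using (argmax; argmax-all; f[xs]≤f[argmax])
open import Data.List.Membership.Propositional using (_∈_)
open import Data.List.Membership.Propositional.Properties using (∈-cartesianProductWith⁺; ∈-filter⁺)
import Data.List.Relation.Unary.All as All
open import Data.List.Relation.Unary.All.Properties using (all-filter)
open import Data.List.Relation.Unary.Any using (here; there)
open import Data.Nat.Base as ℕ using (ℕ; zero; suc)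
import Data.Nat.Properties as ℕ
open import Data.Product.Base using (_×_; _,_; ∃; proj₁; proj₂)
open import Data.Sign.Base using (Sign)
open import Data.Vec.Base as Vec using (Vec; []; _∷_; lookup; tabulate; count)
open import Data.Vec.Functional as Vector using (Vector)
open import Relation.Binary.Construct.Closure.ReflexiveTransitive using (Star)
open import Relation.Binary.Core using (Rel)
open import Relation.Binary.Definitions using (Decidable; Symmetric; Irreflexive)
open import Relation.Binary.PropositionalEquality
open import Relation.Nullary.Decidable using (yes; no; does; _×-dec_; _⊎-dec_)
open import Relation.Nullary.Negation using (contradiction)
import Relation.Unary as Unary

record SimpleGraph (n : ℕ) : Set₁ where
  field
    Adj    : Rel (Fin n) 0ℓ
    adj?   : Decidable Adj
    symm   : Symmetric Adj
    irrefl : Irreflexive _≡_ Adj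

module _ {n : ℕ} (G : SimpleGraph n) where
  open SimpleGraph G

  Connected : Set
  Connected = ∀ u v → Star Adj u v

  -- Each edge {u , v} is listed once, as the pair with u < v.
  edges : List (Fin n × Fin n)
  edges = List.filter (λ (u , v) → (u <? v) ×-dec adj? u v)
                      (List.cartesianProduct (List.allFin n) (List.allFin n))

  size : ℕ
  size = List.length edges

  Edge : Set
  Edge = Fin size

  endpoints : Edge → Fin n × Fin n
  endpoints = List.lookup edges

  incidentEdges : Fin n → Subset size
  incidentEdges v = tabulate λ e →
    does ((v ≟ proj₁ (endpoints e)) ⊎-dec (v ≟ proj₂ (endpoints e)))

  -- Functions E(G) → {-1, 1}; a sign s stands for the integer s ◃ 1.
  Signing : Set
  Signing = Edge → Sign

  weight : Signing → Subset size → ℤ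
  weight f S = sum λ e → if lookup S e then f e ◃ 1 else 0ℤ

  totalWeight : Signing → ℤ
  totalWeight f = weight f ⊤

  Light : Signing → Unary.Pred (Fin n) 0ℓ
  Light f v = weight f (incidentEdges v) ℤ.≤ 1ℤ

  light? : ∀ f → Unary.Decidable (Light f)
  light? f v = weight f (incidentEdges v) ℤ.≤? 1ℤ

  IsSignedSubmatching : ℕ → Signing → Set
  IsSignedSubmatching k f = k ℕ.≤ count (light? f) (Vec.allFin n)

  isSignedSubmatching? : ∀ k → Unary.Decidable (IsSignedSubmatching k)
  isSignedSubmatching? k f = k ℕ.≤? count (light? f) (Vec.allFin n)

allSignVectors : ∀ m → List (Vector Sign m)
allSignVectors zero    = Vector.[] ∷ []
allSignVectors (suc m) =
  List.cartesianProductWith Vector._∷_ (Sign.+ ∷ Sign.- ∷ []) (allSignVectors m)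

module _ {n : ℕ} (G : SimpleGraph n) where

  negative : Signing G
  negative _ = Sign.-

  -- The seed `negative` of argmax is itself a signed k-submatching when k ≤ n
  -- (negative-isSignedSubmatching), so it does not affect the maximum then.
  -- For k > n there is no signed k-submatching and the value is meaningless.
  optimalSigning : ℕ → Signing G
  optimalSigning k = argmax (totalWeight G) negative
    (List.filter (isSignedSubmatching? G k) (allSignVectors (size G)))

  signedSubmatchingNumber : ℕ → ℤ
  signedSubmatchingNumber k = totalWeight G (optimalSigning k)

allSignVectors-complete : ∀ {m} (f : Vector Sign m) →
                          ∃ λ g → g ∈ allSignVectors m × f ≗ g
allSignVectors-complete {zero}  f = Vector.[] , here refl , λ ()
allSignVectors-complete {suc m} f =
  let g , g∈ , f≗g = allSignVectors-complete (Vector.tail f)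
  in  f zero Vector.∷ g
    , ∈-cartesianProductWith⁺ Vector._∷_ (sign∈ (f zero)) g∈
    , λ { zero → refl ; (suc i) → f≗g i }
  where
  sign∈ : ∀ s → s ∈ Sign.+ ∷ Sign.- ∷ []
  sign∈ Sign.+ = here refl
  sign∈ Sign.- = there (here refl)

module _ {a p} {A : Set a} {P : Unary.Pred A p} where

  count-all : (P? : Unary.Decidable P) → (∀ x → P x) →
              ∀ {m} (xs : Vec A m) → count P? xs ≡ m
  count-all P? all []       = refl
  count-all P? all (x ∷ xs) with P? x
  ... | yes _ = cong suc (count-all P? all xs)
  ... | no ¬p = contradiction (all x) ¬p

  count-mono : ∀ {q} {Q : Unary.Pred A q} (P? : Unary.Decidable P) (Q? : Unary.Decidable Q) →
               (∀ {x} → P x → Q x) →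
               ∀ {m} (xs : Vec A m) → count P? xs ℕ.≤ count Q? xs
  count-mono P? Q? P⊆Q []       = ℕ.z≤n
  count-mono P? Q? P⊆Q (x ∷ xs) with P? x | Q? x
  ... | yes _ | yes _ = ℕ.s≤s (count-mono P? Q? P⊆Q xs)
  ... | yes p | no ¬q = contradiction (P⊆Q p) ¬q
  ... | no _  | yes _ = ℕ.m≤n⇒m≤1+n (count-mono P? Q? P⊆Q xs)
  ... | no _  | no _  = count-mono P? Q? P⊆Q xs

sum-nonPositive : ∀ {m} (t : Vector ℤ m) → (∀ i → t i ℤ.≤ 0ℤ) → sum t ℤ.≤ 0ℤ
sum-nonPositive {zero}  t t≤0 = ℤ.≤-refl
sum-nonPositive {suc m} t t≤0 =
  ℤ.+-mono-≤ (t≤0 zero) (sum-nonPositive (Vector.tail t) (λ i → t≤0 (suc i)))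

module _ {n : ℕ} (G : SimpleGraph n) where

  weight-cong : ∀ {f g : Signing G} → f ≗ g → ∀ S → weight G f S ≡ weight G g S
  weight-cong f≗g S =
    sum-cong-≗ λ e → cong (λ s → if lookup S e then s ◃ 1 else 0ℤ) (f≗g e)

  isSignedSubmatching-resp-≗ : ∀ {k} {f g : Signing G} → f ≗ g →
    IsSignedSubmatching G k f → IsSignedSubmatching G k g
  isSignedSubmatching-resp-≗ {f = f} {g} f≗g k≤ = ℕ.≤-trans k≤
    (count-mono (light? G f) (light? G g)
      (λ {v} → subst (ℤ._≤ 1ℤ) (weight-cong f≗g (incidentEdges G v)))
      (Vec.allFin n))

  negative-isSignedSubmatching : ∀ {k} → k ℕ.≤ n → IsSignedSubmatching G k (negative G)
  negative-isSignedSubmatching {k} k≤n =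
    subst (k ℕ.≤_) (sym (count-all (light? G (negative G)) light (Vec.allFin n))) k≤n
    where
    term≤0 : ∀ b → (if b then -1ℤ else 0ℤ) ℤ.≤ 0ℤ
    term≤0 true  = ℤ.-≤+
    term≤0 false = ℤ.≤-refl

    light : ∀ v → Light G (negative G) v
    light v = ℤ.≤-trans (sum-nonPositive _ (λ e → term≤0 (lookup (incidentEdges G v) e)))
                        (ℤ.+≤+ ℕ.z≤n)

  optimalSigning-isSignedSubmatching : ∀ {k} → k ℕ.≤ n →
    IsSignedSubmatching G k (optimalSigning G k)
  optimalSigning-isSignedSubmatching {k} k≤n =
    argmax-all (totalWeight G) (negative-isSignedSubmatching k≤n)
      (all-filter (isSignedSubmatching? G k) (allSignVectors (size G)))

  totalWeight≤signedSubmatchingNumber : ∀ {k} (f : Signing G) →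
    IsSignedSubmatching G k f → totalWeight G f ℤ.≤ signedSubmatchingNumber G k
  totalWeight≤signedSubmatchingNumber {k} f f-sub =
    let g , g∈ , f≗g = allSignVectors-complete f
        g-sub = isSignedSubmatching-resp-≗ f≗g f-sub
    in  subst (ℤ._≤ signedSubmatchingNumber G k) (sym (weight-cong f≗g ⊤))
          (All.lookup (f[xs]≤f[argmax] {f = totalWeight G} (negative G) _)
            (∈-filter⁺ (isSignedSubmatching? G k) g∈ g-sub))

{-# OPTIONS --safe #-}
module Submission where

open import Defs
open import Data.Nat.Base using (ℕ) renaming (_≤_ to _≤ℕ_)
open import Data.Integer.Base using (+_; 1ℤ; _-_; _≥_)

open import Data.Bool.Base using (Bool; true; false; if_then_else_)
open import Data.Empty using (⊥)
open import Data.Fin.Base using (Fin; zero; suc; fromℕ<)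
open import Data.Fin.Properties as Fin using (_≟_)
open import Data.Integer.Base as ℤ using (ℤ; 0ℤ; -1ℤ; _◃_)
import Data.Integer.Properties as ℤ
open import Data.Integer.Tactic.RingSolver using (solve-∀)
open import Algebra.Properties.CommutativeMonoid.Sum ℤ.+-0-commutativeMonoid
  using (sum; sum-cong-≗)
open import Data.List.Base as List using (List; []; _∷_; [_]; _++_; length; concatMap)
open import Data.List.Membership.Propositional using (_∈_; find)
open import Data.List.Membership.Propositional.Properties
  using (∈-++⁻; ∈-∃++; ∈-concatMap⁻; ∈-allFin; ∈-cartesianProduct⁺; ∈-filter⁺)
import Data.List.Properties as List
open import Data.List.Relation.Binary.Permutation.Propositional
  using (_↭_; refl; prep; swap; ↭-sym; ↭-trans; ↭-reflexive)
open import Data.List.Relation.Binary.Permutation.Propositional.Properties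
  using (∈-resp-↭; ↭-map-inv; ↭-length; ++⁺ˡ; ++⁺ʳ; ++-comm; shift; shifts)
open import Data.List.Relation.Unary.All as All using (All; []; _∷_)
import Data.List.Relation.Unary.All.Properties as All
open import Data.List.Relation.Unary.AllPairs using (AllPairs; []; _∷_)
open import Data.List.Relation.Unary.Any using (here; there)
open import Data.List.Relation.Unary.Unique.Propositional using (Unique)
import Data.List.Relation.Unary.Unique.Propositional.Properties as Unique
import Data.Nat.Base as ℕ
import Data.Nat.Properties as ℕ
open import Data.Product.Base using (_×_; _,_; ∃; ∃₂; proj₁; proj₂)
open import Data.Sign.Base using (Sign; opposite)
import Data.Sign.Properties as Sign
open import Data.Sum.Base as Sum using (_⊎_; inj₁; inj₂)
open import Data.Vec.Base as Vec using (Vec; []; _∷_; lookup; tabulate; count)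
import Data.Vec.Properties as Vec
open import Function.Base using (_∘_; case_of_)
open import Relation.Binary.Construct.Closure.ReflexiveTransitive as Star using (Star; ε; _◅_)
open import Relation.Binary.Definitions using (tri<; tri≈; tri>)
open import Relation.Binary.PropositionalEquality
  using (_≡_; _≢_; refl; sym; trans; cong; cong₂; subst; module ≡-Reasoning)
open import Relation.Nullary.Decidable
  using (Dec; yes; no; does; ¬?; _×-dec_; _⊎-dec_; dec-false; toSum)
open import Relation.Nullary.Negation using (contradiction)
import Relation.Unary as Unary
open import Relation.Unary.Properties using (U?)

-- Write the edges as a sequence of trails and concatenate trails that share an
-- end, or splice a closed trail into another one it meets. By connectivity this
-- stops with either open trails whose ends are all distinct, or a single closed
-- trail. Sign the edges alternately along the whole sequence: interior visits
-- cancel, so every vertex is light, except possibly the base point of an odd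
-- closed trail, and the total is 0 or the first sign. Starting with − this gives
-- the case k = n, starting with + the case k = n − 1. Smaller k follow in steps
-- of 2 by changing a − to a +; when no − is left the total is |E| ≥ n − 1.

-- Searching a list up to permutation.

∈⇒↭ : ∀ {a} {A : Set a} {x : A} {xs} → x ∈ xs → ∃ λ ys → xs ↭ x ∷ ys
∈⇒↭ x∈xs with ys , zs , refl ← ∈-∃++ x∈xs = ys ++ zs , shift _ ys zs

-- Each element is tested against all later ones. Applied to trails, a hit brings two mergeable
-- trails to the front, and a failure certifies that all their ends are apart.
pairOrAllPairs : ∀ {a p q} {A : Set a} {P : A → A → Set p} {Q : A → A → Set q} →
  (∀ x y → P x y ⊎ Q x y) → ∀ xs →
  (∃₂ λ x y → ∃ λ zs → xs ↭ x ∷ y ∷ zs × P x y) ⊎ AllPairs Q xs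
pairOrAllPairs d []       = inj₂ []
pairOrAllPairs d (x ∷ xs) with All.decide (Sum.swap ∘ d x) xs | pairOrAllPairs d xs
... | inj₂ any | _ = let y , y∈ , p = find any ; zs , σ = ∈⇒↭ y∈
                     in inj₁ (x , y , zs , prep x σ , p)
... | inj₁ _   | inj₁ (y , z , zs , σ , p) =
  inj₁ (y , z , x ∷ zs
       , ↭-trans (prep x σ) (↭-trans (swap x y refl) (prep y (swap x z refl))) , p)
... | inj₁ all | inj₂ pairs = inj₂ (all ∷ pairs)

-- Walks, trails and their concatenation.

module _ {n : ℕ} where

  private
    V E : Set
    V = Fin n
    E = V × V

  -- An edge is stored as an ordered pair, yet a walk may cross it either way. The inequality
  -- carried along makes `incident-Joins` true.
  data Joins : E → V → V → Set where
    forth : ∀ {x y} → x ≢ y → Joins (x , y) x y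
    back  : ∀ {x y} → x ≢ y → Joins (y , x) x y

  Joins-sym : ∀ {e x y} → Joins e x y → Joins e y x
  Joins-sym (forth x≢y) = back (x≢y ∘ sym)
  Joins-sym (back x≢y)  = forth (x≢y ∘ sym)

  Joins-endpoint : ∀ {e x y u w} → Joins e x y → Joins e u w → u ≡ x ⊎ u ≡ y
  Joins-endpoint (forth _) (forth _) = inj₁ refl
  Joins-endpoint (forth _) (back _)  = inj₂ refl
  Joins-endpoint (back _)  (forth _) = inj₂ refl
  Joins-endpoint (back _)  (back _)  = inj₁ refl

  Loopless : List E → Set
  Loopless = All (λ (a , b) → a ≢ b)

  Linked : List E → V → V → Set
  Linked es u w = ∃ λ e → e ∈ es × Joins e u w

  data Walk : V → V → List E → Set where
    []  : ∀ {x} → Walk x x []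
    _∷_ : ∀ {e x y z es} → Joins e x y → Walk y z es → Walk x z (e ∷ es)

  infixr 5 _⋯_
  _⋯_ : ∀ {x y z es fs} → Walk x y es → Walk y z fs → Walk x z (es ++ fs)
  []      ⋯ w = w
  (j ∷ v) ⋯ w = j ∷ (v ⋯ w)

  reversed : ∀ {x y es} → Walk x y es → ∃ λ fs → Walk y x fs × fs ↭ es
  reversed []      = [] , [] , refl
  reversed (j ∷ w) = let fs , v , σ = reversed w
                     in fs ++ [ _ ] , v ⋯ (Joins-sym j ∷ []) , ↭-trans (++-comm fs _) (prep _ σ)

  -- Both halves of the walk are kept, so that a closed walk can be rotated to `u` and any trail cut
  -- open there.
  Visits : V → V → V → List E → Set
  Visits u x y es = ∃₂ λ fs gs → Walk x u fs × Walk u y gs × fs ++ gs ≡ es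

  visits : ∀ {x y u w e es} → Walk x y es → e ∈ es → Joins e u w → Visits u x y es
  visits (j ∷ v) (here refl) k with Joins-endpoint j k
  ... | inj₁ refl = [] , _ , [] , j ∷ v , refl
  ... | inj₂ refl = [ _ ] , _ , j ∷ [] , v , refl
  visits (j ∷ v) (there e∈) k with fs , gs , v₁ , v₂ , refl ← visits v e∈ k =
    _ ∷ fs , gs , j ∷ v₁ , v₂ , refl

  -- That no edge is used twice is enforced globally: the invariant `traces ts ↭ es` makes the
  -- trails together use every entry of `es` exactly once.
  record Trail : Set where
    constructor trail
    field
      {start end} : V
      {trace}     : List E
      walk        : Walk start end trace
  open Trail

  traces : List Trail → List E
  traces = concatMap trace

  traces-↭ : ∀ {ts us} → ts ↭ us → traces ts ↭ traces us
  traces-↭ refl             = refl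
  traces-↭ (prep t σ)       = ++⁺ˡ (trace t) (traces-↭ σ)
  traces-↭ (swap t u σ)     = ↭-trans (shifts (trace t) (trace u))
                                      (++⁺ˡ (trace u) (++⁺ˡ (trace t) (traces-↭ σ)))
  traces-↭ (_↭_.trans σ τ) = ↭-trans (traces-↭ σ) (traces-↭ τ)

  Endpoint : Trail → V → Set
  Endpoint t v = v ≡ start t ⊎ v ≡ end t

  Open : Trail → Set
  Open t = start t ≢ end t

  Apart : Trail → Trail → Set
  Apart t u = ∀ {v} → Endpoint t v → Endpoint u v → ⊥

  Mergeable : Trail → Trail → Set
  Mergeable t u = ∃ λ w → trace w ↭ trace t ++ trace u

  -- A shared end allows concatenation, after reversing one trail if two starts or two ends
  -- coincide.
  mergeable? : ∀ t u → Mergeable t u ⊎ Apart t u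
  mergeable? (trail {a} {b} v) (trail {c} {d} w) with b ≟ c | a ≟ c | b ≟ d | a ≟ d
  ... | yes refl | _ | _ | _ = inj₁ (trail (v ⋯ w) , refl)
  ... | _ | yes refl | _ | _ = let _ , v′ , σ = reversed v in inj₁ (trail (v′ ⋯ w) , ++⁺ʳ _ σ)
  ... | _ | _ | yes refl | _ = let _ , w′ , σ = reversed w in inj₁ (trail (v ⋯ w′) , ++⁺ˡ _ σ)
  ... | _ | _ | _ | yes refl = inj₁ (trail (w ⋯ v) , ++-comm (trace (trail w)) (trace (trail v)))
  ... | no b≢c | no a≢c | no b≢d | no a≢d = inj₂ λ where
    (inj₁ refl) (inj₁ eq) → a≢c eq
    (inj₁ refl) (inj₂ eq) → a≢d eq
    (inj₂ refl) (inj₁ eq) → b≢c eq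
    (inj₂ refl) (inj₂ eq) → b≢d eq

  -- The closed walk is rotated to start at the common vertex u.
  splice : ∀ {u x es} t → Visits u x x es → Visits u (start t) (end t) (trace t) →
           ∃ λ w → trace w ↭ es ++ trace t
  splice {es = es} t (fs , gs , v₁ , v₂ , refl) (hs , ks , w₁ , w₂ , refl) =
    trail (w₁ ⋯ (v₂ ⋯ v₁) ⋯ w₂) ,
    ↭-trans (shifts hs (gs ++ fs)) (++⁺ʳ (hs ++ ks) (++-comm gs fs))

  data Reduced (es : List E) : Set where
    paths : ∀ ts → All Open ts → AllPairs Apart ts → traces ts ↭ es → Reduced es
    cycle : ∀ {x fs} → Walk x x fs → fs ↭ es → Reduced es

  -- Reduction of a connected edge list to open trails or one closed trail.

  module _ {es : List E} (connected : ∀ u v → Star (Linked es) u v) where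

    -- Follow the path from `s` as long as its edges lie in `fs`; every vertex reached is again
    -- visited by the closed walk. The first edge in `gs` therefore leaves from a visited vertex. If
    -- the path ends before that, `a` itself is visited and `e` is such an edge.
    escape : ∀ {x fs gs s a b e} → Walk x x fs → es ↭ fs ++ gs →
      Visits s x x fs → Star (Linked es) s a → e ∈ gs → Joins e a b →
      ∃ λ u → ∃₂ λ w f → f ∈ gs × Joins f u w × Visits u x x fs
    escape c σ vs ε e∈ j = _ , _ , _ , e∈ , j , vs
    escape {fs = fs} c σ vs ((f , f∈ , k) ◅ ss) e∈ j with ∈-++⁻ fs (∈-resp-↭ σ f∈)
    ... | inj₁ f∈fs = escape c σ (visits c f∈fs (Joins-sym k)) ss e∈ j
    ... | inj₂ f∈gs = _ , _ , _ , f∈gs , k , vs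

    -- If edges remain outside the closed walk, `escape` yields one touching it, and the trail
    -- containing that edge takes the closed walk in by `splice`. The closed walk is not counted in
    -- `ts`, so equal lengths mean one trail fewer overall.
    absorb : ∀ {x fs} → Walk x x fs → ∀ ts → fs ++ traces ts ↭ es →
             Loopless (traces ts) →
             fs ↭ es ⊎ ∃ λ us → traces us ↭ es × length us ≡ length ts
    absorb {x} {fs} c ts σ loopless with traces ts in eq
    -- Trails still present in `ts` have empty traces and are dropped.
    ... | [] = inj₁ (subst (_↭ es) (List.++-identityʳ fs) σ)
    ... | (a , b) ∷ _ with a≢b ∷ _ ← loopless
      with u , w , f , f∈ , j , vs ←
             escape c (↭-sym σ) ([] , _ , [] , c , refl) (connected x a)
                    (here refl) (forth a≢b)
      with t , t∈ , f∈t ← find (∈-concatMap⁻ trace {xs = ts} (subst (f ∈_) (sym eq) f∈))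
      with us , τ ← ∈⇒↭ t∈
      with r , ρ ← splice t vs (visits (walk t) f∈t j) =
      inj₂ (r ∷ us
           , ↭-trans (++⁺ʳ (traces us) ρ)
               (↭-trans (↭-reflexive (List.++-assoc fs (trace t) (traces us)))
                 (↭-trans (++⁺ˡ fs (↭-trans (↭-sym (traces-↭ τ)) (↭-reflexive eq))) σ))
           , sym (↭-length τ))

    -- Merging two trails and absorbing a closed one both lower the number of trails by one, the
    -- measure on which `reduce` recurses.
    reduceStep : ∀ ts → traces ts ↭ es → Loopless es →
      Reduced es ⊎ ∃ λ us → traces us ↭ es × length ts ≡ ℕ.suc (length us)
    reduceStep ts σ loopless with pairOrAllPairs mergeable? ts
    ... | inj₁ (t , u , us , τ , w , ρ) =
      inj₂ (w ∷ us
           , ↭-trans (++⁺ʳ (traces us) ρ)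
               (↭-trans (↭-reflexive (List.++-assoc (trace t) (trace u) (traces us)))
                 (↭-trans (↭-sym (traces-↭ τ)) σ))
           , ↭-length τ)
    ... | inj₂ apart with All.decide (λ t → Sum.swap (toSum (start t ≟ end t))) ts
    ...   | inj₁ opens = inj₁ (paths ts opens apart σ)
    ...   | inj₂ any
      with trail c , t∈ , refl ← find any
      with us , τ ← ∈⇒↭ t∈
      with absorb c us (↭-trans (↭-sym (traces-↭ τ)) σ)
             (All.++⁻ʳ _ (All.tabulate λ e∈ →
               All.lookup loopless (∈-resp-↭ (↭-trans (↭-sym (traces-↭ τ)) σ) e∈)))
    ...     | inj₁ ρ = inj₁ (cycle c ρ)
    ...     | inj₂ (vs , ρ , len) = inj₂ (vs , ρ , trans (↭-length τ) (cong ℕ.suc (sym len)))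

    reduce : ∀ k ts → length ts ≡ k → traces ts ↭ es → Loopless es → Reduced es
    reduce k ts len σ loopless with reduceStep ts σ loopless
    ... | inj₁ done = done
    reduce ℕ.zero    ts len σ loopless | inj₂ (us , τ , len′) with () ← trans (sym len) len′
    reduce (ℕ.suc k) ts len σ loopless | inj₂ (us , τ , len′) =
      reduce k us (ℕ.suc-injective (trans (sym len′) len)) τ loopless

    singletons : ∀ {fs} → Loopless fs → ∃ λ ts → traces ts ≡ fs
    singletons []           = [] , refl
    singletons (a≢b ∷ rest) = let ts , eq = singletons rest
                              in trail (forth a≢b ∷ []) ∷ ts , cong (_ ∷_) eq

    reduced : Loopless es → Reduced es
    reduced loopless = let ts , eq = singletons loopless
                       in reduce _ ts refl (↭-reflexive eq) loopless

-- Alternating signs along a list of edges.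

+-congˡ : ∀ i {j k} → j ≡ k → i ℤ.+ j ≡ i ℤ.+ k
+-congˡ i = cong (λ j → i ℤ.+ j)

+-leftComm : ∀ i j k → i ℤ.+ (j ℤ.+ k) ≡ j ℤ.+ (i ℤ.+ k)
+-leftComm = solve-∀

+-≤-identityˡ : ∀ {c i j k} → c ≡ i ℤ.+ j → i ≡ 0ℤ → j ℤ.≤ k → c ℤ.≤ k
+-≤-identityˡ {j = j} {k} refl refl = subst (λ i → i ℤ.≤ k) (sym (ℤ.+-identityˡ j))

+-≤-identityʳ : ∀ {c i j k} → c ≡ i ℤ.+ j → j ≡ 0ℤ → i ℤ.≤ k → c ℤ.≤ k
+-≤-identityʳ {i = i} {k = k} refl refl = subst (λ i → i ℤ.≤ k) (sym (ℤ.+-identityʳ i))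

opposite-cancels : ∀ s → (s ◃ 1) ℤ.+ (opposite s ◃ 1) ≡ 0ℤ
opposite-cancels Sign.+ = refl
opposite-cancels Sign.- = refl

module _ {a} {A : Set a} where

  alternate : Sign → List A → List (A × Sign)
  alternate s []       = []
  alternate s (x ∷ xs) = (x , s) ∷ alternate (opposite s) xs

  map-proj₁-alternate : ∀ s xs → List.map proj₁ (alternate s xs) ≡ xs
  map-proj₁-alternate s []       = refl
  map-proj₁-alternate s (x ∷ xs) = cong (x ∷_) (map-proj₁-alternate (opposite s) xs)

  -- The parity of the length of `xs` decides between `s` and its opposite. The bounds on trails
  -- hold for either starting sign, so `s′` is left unspecified.
  alternate-++ : ∀ s xs ys →
    ∃ λ s′ → alternate s (xs ++ ys) ≡ alternate s xs ++ alternate s′ ys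
  alternate-++ s []       ys = s , refl
  alternate-++ s (x ∷ xs) ys = let s′ , eq = alternate-++ (opposite s) xs ys
                               in s′ , cong (_ ∷_) eq

  -- Taking incidence with a vertex for `h` gives the weight at that vertex; taking the constant
  -- `true` gives the total weight.
  charge₁ : (A → Bool) → A → Sign → ℤ
  charge₁ h x s = if h x then s ◃ 1 else 0ℤ

  charge : (A → Bool) → List (A × Sign) → ℤ
  charge h []            = 0ℤ
  charge h ((x , s) ∷ L) = charge₁ h x s ℤ.+ charge h L

  charge-++ : ∀ h L M → charge h (L ++ M) ≡ charge h L ℤ.+ charge h M
  charge-++ h []            M = sym (ℤ.+-identityˡ _)
  charge-++ h ((x , s) ∷ L) M =
    trans (+-congˡ (charge₁ h x s) (charge-++ h L M))
          (sym (ℤ.+-assoc (charge₁ h x s) (charge h L) (charge h M)))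

  charge-↭ : ∀ h {L M} → L ↭ M → charge h L ≡ charge h M
  charge-↭ h refl             = refl
  charge-↭ h (prep (x , s) σ) = +-congˡ (charge₁ h x s) (charge-↭ h σ)
  charge-↭ h (swap {ys = ys} (x , s) (y , t) σ) =
    trans (+-congˡ (charge₁ h x s) (+-congˡ (charge₁ h y t) (charge-↭ h σ)))
          (+-leftComm (charge₁ h x s) (charge₁ h y t) (charge h ys))
  charge-↭ h (_↭_.trans σ τ)  = trans (charge-↭ h σ) (charge-↭ h τ)

  -- Consecutive signs cancel in pairs; an odd length leaves one copy of the first sign.
  total-alternate : ∀ s (xs : List A) →
    charge (λ _ → true) (alternate s xs) ≡ 0ℤ ⊎ charge (λ _ → true) (alternate s xs) ≡ s ◃ 1
  total-alternate s []       = inj₁ refl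
  total-alternate s (x ∷ xs) with total-alternate (opposite s) xs
  ... | inj₁ eq = inj₂ (trans (+-congˡ (s ◃ 1) eq) (ℤ.+-identityʳ (s ◃ 1)))
  ... | inj₂ eq = inj₁ (trans (+-congˡ (s ◃ 1) eq) (opposite-cancels s))

  signingOf : ∀ (L : List (A × Sign)) {xs} → List.map proj₁ L ≡ xs →
    ∃ λ (f : Fin (length xs) → Sign) →
      ∀ h → sum (λ e → charge₁ h (List.lookup xs e) (f e)) ≡ charge h L
  signingOf []            refl = (λ ()) , λ h → refl
  signingOf ((x , s) ∷ L) refl =
    let f , f≡ = signingOf L refl
    in (λ { zero → s ; (suc e) → f e }) , λ h → +-congˡ (charge₁ h x s) (f≡ h)

  -- Signs alternate in the order of `fs`, while a signing is indexed by positions in `es`;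
  -- `↭-map-inv` carries the signed list over to that order. As `h` is quantified after `f`, one
  -- signing serves all vertices and the total.
  distribute : ∀ {fs es} → fs ↭ es → ∀ s → ∃ λ (f : Fin (length es) → Sign) →
    ∀ h → sum (λ e → charge₁ h (List.lookup es e) (f e)) ≡ charge h (alternate s fs)
  distribute {fs} {es} σ s
    with L , eq , τ ← ↭-map-inv proj₁ (subst (_↭ es) (sym (map-proj₁-alternate s fs)) σ)
    with f , f≡ ← signingOf L (sym eq) = f , λ h → trans (f≡ h) (sym (charge-↭ h τ))

-- Charges of alternately signed trails at a vertex.

module _ {n : ℕ} where

  open Trail

  incident : Fin n → Fin n × Fin n → Bool
  incident v (x , y) = does ((v ≟ x) ⊎-dec (v ≟ y))

  -- The share of an edge of sign `s` that falls on `v` through its end `x`. Splitting an edge into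
  -- two shares lets each cancel with the neighbouring edge of a walk.
  at : Fin n → Fin n → Sign → ℤ
  at v x s = if does (v ≟ x) then s ◃ 1 else 0ℤ

  at-≢ : ∀ {v x} s → v ≢ x → at v x s ≡ 0ℤ
  at-≢ {v} {x} s v≢x with v ≟ x
  ... | yes v≡x = contradiction v≡x v≢x
  ... | no _    = refl

  at≤1 : ∀ v x s → at v x s ℤ.≤ 1ℤ
  at≤1 v x s with v ≟ x | s
  ... | yes _ | Sign.+ = ℤ.≤-refl
  ... | yes _ | Sign.- = ℤ.-≤+
  ... | no _  | _      = ℤ.+≤+ ℕ.z≤n

  at-cancels : ∀ v x s → at v x s ℤ.+ at v x (opposite s) ≡ 0ℤ
  at-cancels v x s with v ≟ x
  ... | yes _ = opposite-cancels s
  ... | no _  = refl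

  -- The ends are distinct, so `v` equals at most one of them and the disjunction in `incident` acts
  -- as a sum.
  incident-Joins : ∀ v {e x y} s → Joins e x y →
    charge₁ (incident v) e s ≡ at v x s ℤ.+ at v y s
  incident-Joins v {x = x} {y} s (forth x≢y) with v ≟ x | v ≟ y
  ... | yes refl | yes refl = contradiction refl x≢y
  ... | yes _    | no _     = sym (ℤ.+-identityʳ _)
  ... | no _     | yes _    = sym (ℤ.+-identityˡ _)
  ... | no _     | no _     = refl
  incident-Joins v {x = x} {y} s (back x≢y) with v ≟ x | v ≟ y
  ... | yes refl | yes refl = contradiction refl x≢y
  ... | yes _    | no _     = sym (ℤ.+-identityʳ _)
  ... | no _     | yes _    = sym (ℤ.+-identityˡ _)
  ... | no _     | no _     = refl

  -- Consecutive edges of a walk cancel at the vertex between them.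
  charge-walk : ∀ {x y es} → Walk x y es → ∀ s → ∃ λ s′ → ∀ v →
    charge (incident v) (alternate s es) ≡ at v x s ℤ.+ at v y s′
  -- An empty walk has no last edge; with the opposite sign the two terms at `x` cancel to the empty
  -- charge.
  charge-walk {x} []                s = opposite s , λ v → sym (at-cancels v x s)
  charge-walk {x} {y} (_∷_ {e} {y = z} {es = es} j w) s with s′ , eq ← charge-walk w (opposite s) =
    s′ , λ v → begin
      charge₁ (incident v) e s ℤ.+ charge (incident v) (alternate (opposite s) es)
        ≡⟨ cong₂ ℤ._+_ (incident-Joins v s j) (eq v) ⟩
      (at v x s ℤ.+ at v z s) ℤ.+ (at v z (opposite s) ℤ.+ at v y s′)
        ≡⟨ regroup (at v x s) (at v z s) (at v z (opposite s)) (at v y s′) ⟩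
      at v x s ℤ.+ (at v z s ℤ.+ at v z (opposite s) ℤ.+ at v y s′)
        ≡⟨ cong (λ c → at v x s ℤ.+ (c ℤ.+ at v y s′)) (at-cancels v z s) ⟩
      at v x s ℤ.+ (0ℤ ℤ.+ at v y s′)
        ≡⟨ +-congˡ (at v x s) (ℤ.+-identityˡ (at v y s′)) ⟩
      at v x s ℤ.+ at v y s′ ∎
    where
    open ≡-Reasoning
    regroup : ∀ i j k l → (i ℤ.+ j) ℤ.+ (k ℤ.+ l) ≡ i ℤ.+ (j ℤ.+ k ℤ.+ l)
    regroup = solve-∀

  charge-elsewhere : ∀ t {v} → (Endpoint t v → ⊥) → ∀ s →
    charge (incident v) (alternate s (trace t)) ≡ 0ℤ
  charge-elsewhere t {v} away s with s′ , eq ← charge-walk (walk t) s =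
    trans (eq v) (cong₂ ℤ._+_ (at-≢ s (away ∘ inj₁)) (at-≢ s′ (away ∘ inj₂)))

  -- Only the two ends contribute, and since they differ, `v` receives at most one sign.
  charge-open : ∀ t → Open t → ∀ v s → charge (incident v) (alternate s (trace t)) ℤ.≤ 1ℤ
  charge-open t t-open v s
    with s′ , eq ← charge-walk (walk t) s
    with v ≟ start t
  ... | no v≢    = +-≤-identityˡ (eq v) (at-≢ s v≢) (at≤1 v (end t) s′)
  ... | yes refl = +-≤-identityʳ (eq v) (at-≢ s′ t-open) (at≤1 v (start t) s)

  charge-traces : ∀ t ts v s → ∃ λ s′ →
    charge (incident v) (alternate s (traces (t ∷ ts))) ≡
    charge (incident v) (alternate s (trace t)) ℤ.+ charge (incident v) (alternate s′ (traces ts))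
  charge-traces t ts v s with s′ , eq ← alternate-++ s (trace t) (traces ts) =
    s′ , trans (cong (charge (incident v)) eq)
      (charge-++ (incident v) (alternate s (trace t)) (alternate s′ (traces ts)))

  charge-traces-elsewhere : ∀ ts {v} → All (λ t → Endpoint t v → ⊥) ts → ∀ s →
    charge (incident v) (alternate s (traces ts)) ≡ 0ℤ
  charge-traces-elsewhere []       []             s = refl
  charge-traces-elsewhere (t ∷ ts) {v} (away ∷ aways) s with s′ , eq ← charge-traces t ts v s =
    trans eq (cong₂ ℤ._+_ (charge-elsewhere t away s) (charge-traces-elsewhere ts aways s′))

  -- A vertex is an end of at most one of the trails. All others charge it 0, whichever sign they
  -- start with.
  charge-traces-apart : ∀ ts → All Open ts → AllPairs Apart ts → ∀ v s →
    charge (incident v) (alternate s (traces ts)) ℤ.≤ 1ℤ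
  charge-traces-apart []       []               []              v s = ℤ.+≤+ ℕ.z≤n
  charge-traces-apart (t ∷ ts) (t-open ∷ opens) (apart ∷ aparts) v s
    with s′ , eq ← charge-traces t ts v s
    with (v ≟ start t) ⊎-dec (v ≟ end t)
  ... | yes at-end = +-≤-identityʳ eq
          (charge-traces-elsewhere ts (All.map (λ a → a at-end) apart) s′)
          (charge-open t t-open v s)
  ... | no away = +-≤-identityˡ eq (charge-elsewhere t away s)
          (charge-traces-apart ts opens aparts v s′)

  charge-cycle-elsewhere : ∀ {x es} → Walk x x es → ∀ {v} → v ≢ x → ∀ s →
    charge (incident v) (alternate s es) ℤ.≤ 1ℤ
  charge-cycle-elsewhere c v≢x s =
    ℤ.≤-trans (ℤ.≤-reflexive (charge-elsewhere (trail c) (λ { (inj₁ eq) → v≢x eq ; (inj₂ eq) → v≢x eq }) s))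
              (ℤ.+≤+ ℕ.z≤n)

  -- Both ends lie at `x`: the first sign contributes at most 0 and the last at most 1.
  charge-cycle-negative : ∀ {x es} → Walk x x es → ∀ v →
    charge (incident v) (alternate Sign.- es) ℤ.≤ 1ℤ
  charge-cycle-negative {x} c v with s′ , eq ← charge-walk c Sign.- =
    subst (ℤ._≤ 1ℤ) (sym (eq v)) (ℤ.+-mono-≤ at-≤0 (at≤1 v x s′))
    where
    at-≤0 : at v x Sign.- ℤ.≤ 0ℤ
    at-≤0 with v ≟ x
    ... | yes _ = ℤ.-≤+
    ... | no _  = ℤ.≤-refl

  negative-light : ∀ {es} → Reduced es → ∃ λ fs → fs ↭ es ×
    ∀ v → charge (incident v) (alternate Sign.- fs) ℤ.≤ 1ℤ
  negative-light (paths ts opens aparts σ) =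
    traces ts , σ , λ v → charge-traces-apart ts opens aparts v Sign.-
  negative-light (cycle c σ) = _ , σ , charge-cycle-negative c

  -- Starting with +, an odd closed trail charges its base point with 2, so that vertex is excepted.
  -- For open trails the given element of `Fin n` fills the place of the exception.
  positive-light : ∀ {es} → Fin n → Reduced es → ∃ λ fs → fs ↭ es ×
    ∃ λ x → ∀ v → v ≢ x → charge (incident v) (alternate Sign.+ fs) ℤ.≤ 1ℤ
  positive-light x (paths ts opens aparts σ) =
    traces ts , σ , x , λ v _ → charge-traces-apart ts opens aparts v Sign.+
  positive-light _ (cycle {x} c σ) =
    _ , σ , x , λ v v≢x → charge-cycle-elsewhere c v≢x Sign.+

  -- A connected graph on n vertices has at least n - 1 edges.

  length-filter-≢ : ∀ {R : List (Fin n)} y → Unique R →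
    length R ℕ.≤ ℕ.suc (length (List.filter (λ x → ¬? (x ≟ y)) R))
  length-filter-≢ y []               = ℕ.z≤n
  length-filter-≢ {x ∷ R} y (x∉R ∷ R!) with x ≟ y
  ... | no _     = ℕ.s≤s (length-filter-≢ y R!)
  -- Distinctness keeps `y` out of the tail, where the filter thus removes nothing.
  ... | yes refl = ℕ.s≤s (ℕ.≤-reflexive (cong length (sym
                     (List.filter-all (λ z → ¬? (z ≟ x)) (All.map (_∘ sym) x∉R)))))

  -- A labelling contracts the edges of es one at a time, each of which identifies at
  -- most one pair of labels; in a connected graph only one label is left.
  record Labelling (es : List (Fin n × Fin n)) : Set where
    field
      label        : Fin n → Fin n
      invariant    : ∀ {u v} → Linked es u v → label u ≡ label v
      labels       : List (Fin n)
      distinct     : Unique labels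
      attained     : All (λ x → ∃ λ v → label v ≡ x) labels
      sufficient   : n ℕ.≤ length labels ℕ.+ length es

  labelling : ∀ es → Labelling es
  labelling [] = record
    { label      = λ v → v
    ; invariant  = λ { (_ , () , _) }
    ; labels     = List.allFin n
    ; distinct   = Unique.allFin⁺ n
    ; attained   = All.tabulate λ {x} _ → x , refl
    ; sufficient = ℕ.≤-reflexive (sym (trans (ℕ.+-identityʳ _) (List.length-tabulate {n = n} (λ i → i))))
    }
  labelling ((a , b) ∷ es) = record
    { label      = relabel ∘ L.label
    ; invariant  = λ where
        (_ , here refl , forth _) → merged
        (_ , here refl , back _)  → sym merged
        (e , there e∈ , j)        → cong relabel (L.invariant (e , e∈ , j))
    -- The label of `a` is dropped even if `b` already carries it. This is sound, since `labels`
    -- lists some attained labels and loses at most one per edge.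
    ; labels     = List.filter other? L.labels
    ; distinct   = Unique.filter⁺ other? L.distinct
    ; attained   = All.zipWith (λ { (x≢ , v , refl) → v , relabel-≢ x≢ })
                     (All.all-filter other? L.labels , All.filter⁺ other? L.attained)
    ; sufficient = ℕ.≤-trans L.sufficient
                     (ℕ.≤-trans (ℕ.+-monoˡ-≤ (length es) (length-filter-≢ (L.label a) L.distinct))
                                (ℕ.≤-reflexive (sym (ℕ.+-suc _ (length es)))))
    }
    where
    module L = Labelling (labelling es)

    other? : ∀ x → _
    other? x = ¬? (x ≟ L.label a)

    relabel : Fin n → Fin n
    relabel x = if does (x ≟ L.label a) then L.label b else x

    relabel-≢ : ∀ {x} → x ≢ L.label a → relabel x ≡ x
    relabel-≢ {x} x≢ with x ≟ L.label a
    ... | yes eq = contradiction eq x≢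
    ... | no _   = refl

    relabel-≡ : ∀ {x} → x ≡ L.label a → relabel x ≡ L.label b
    relabel-≡ {x} x≡ with x ≟ L.label a
    ... | yes _ = refl
    ... | no ¬eq = contradiction x≡ ¬eq

    merged : relabel (L.label a) ≡ relabel (L.label b)
    merged with L.label b ≟ L.label a
    ... | yes _ = relabel-≡ refl
    ... | no _  = relabel-≡ refl

  connected⇒n≤1+size : ∀ es → (∀ u v → Star (Linked es) u v) → n ℕ.≤ ℕ.suc (length es)
  connected⇒n≤1+size es connected =
    ℕ.≤-trans sufficient (ℕ.+-monoˡ-≤ (length es) (atMostOne distinct attained))
    where
    open Labelling (labelling es)

    constant : ∀ {u v} → Star (Linked es) u v → label u ≡ label v
    constant ε        = refl
    constant (l ◅ ls) = trans (invariant l) (constant ls)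

    atMostOne : ∀ {R} → Unique R → All (λ x → ∃ λ v → label v ≡ x) R → length R ℕ.≤ 1
    atMostOne []      _ = ℕ.z≤n
    atMostOne (_ ∷ []) _ = ℕ.≤-refl
    atMostOne ((x≢y ∷ _) ∷ _) ((u , refl) ∷ (v , refl) ∷ _) =
      contradiction (constant (connected u v)) x≢y

-- Counting vertices up to an exception.

module _ {a p q} {A : Set a} {P : Unary.Pred A p} {Q : Unary.Pred A q}
         (P? : Unary.Decidable P) (Q? : Unary.Decidable Q) where

  count-∪ : ∀ {m} (xs : Vec A m) → count (λ x → P? x ⊎-dec Q? x) xs ℕ.≤ count P? xs ℕ.+ count Q? xs
  count-∪ []       = ℕ.z≤n
  count-∪ (x ∷ xs) with does (P? x) | does (Q? x) | count-∪ xs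
  ... | true  | true  | ih = ℕ.s≤s (ℕ.≤-trans ih (ℕ.+-monoʳ-≤ _ (ℕ.n≤1+n _)))
  ... | true  | false | ih = ℕ.s≤s ih
  ... | false | true  | ih = ℕ.≤-trans (ℕ.s≤s ih) (ℕ.≤-reflexive (sym (ℕ.+-suc _ _)))
  ... | false | false | ih = ih

-- Stated for an injective `g` because the tail of `allFin` is tabulated by `suc`.
count-≟-tabulate : ∀ {n m} (x : Fin n) (g : Fin m → Fin n) → (∀ {i j} → g i ≡ g j → i ≡ j) →
  count (_≟ x) (tabulate g) ℕ.≤ 1
count-≟-tabulate {m = ℕ.zero}  x g inj = ℕ.z≤n
count-≟-tabulate {m = ℕ.suc m} x g inj with g zero ≟ x
... | no _     = count-≟-tabulate x (g ∘ suc) (Fin.suc-injective ∘ inj)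
... | yes refl = ℕ.s≤s (ℕ.≤-reflexive (none (λ i → g (suc i)) λ i eq → case inj eq of λ ()))
  where
  none : ∀ {m} (h : Fin m → Fin _) → (∀ i → h i ≢ g zero) → count (_≟ g zero) (tabulate h) ≡ 0
  none {ℕ.zero}  h h≢ = refl
  none {ℕ.suc m} h h≢ with h zero ≟ g zero
  ... | yes eq = contradiction eq (h≢ zero)
  ... | no _   = none (h ∘ suc) (h≢ ∘ suc)

-- Every vertex in `P` is in `Q` or is `x`, and `x` is counted once. This is the cost of giving up
-- one vertex: the exception of `positive-light`, or an end of a raised edge.
count-except : ∀ {n p q} {P : Unary.Pred (Fin n) p} {Q : Unary.Pred (Fin n) q}
  (P? : Unary.Decidable P) (Q? : Unary.Decidable Q) x → (∀ {v} → v ≢ x → P v → Q v) →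
  count P? (Vec.allFin n) ℕ.≤ ℕ.suc (count Q? (Vec.allFin n))
count-except {n} {Q = Q} P? Q? x P⇒Q = begin
  count P? (Vec.allFin n)                                        ≤⟨ count-mono P? (λ v → Q? v ⊎-dec (v ≟ x)) split (Vec.allFin n) ⟩
  count (λ v → Q? v ⊎-dec (v ≟ x)) (Vec.allFin n)                ≤⟨ count-∪ Q? (_≟ x) (Vec.allFin n) ⟩
  count Q? (Vec.allFin n) ℕ.+ count (_≟ x) (Vec.allFin n)        ≤⟨ ℕ.+-monoʳ-≤ _ (count-≟-tabulate x (λ i → i) (λ eq → eq)) ⟩
  count Q? (Vec.allFin n) ℕ.+ 1                                  ≡⟨ ℕ.+-comm _ 1 ⟩
  ℕ.suc (count Q? (Vec.allFin n))                                ∎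
  where
  open ℕ.≤-Reasoning
  split : ∀ {v} → _ → Q v ⊎ v ≡ x
  split {v} pv with v ≟ x
  ... | yes eq = inj₂ eq
  ... | no ¬eq = inj₁ (P⇒Q ¬eq pv)

-- Transfer from trails to signings of the graph.

module _ {n : ℕ} (G : SimpleGraph n) where

  open SimpleGraph G

  edges-loopless : Loopless (edges G)
  edges-loopless = All.map (λ (u<v , _) → Fin.<⇒≢ u<v)
    (All.all-filter (λ (u , v) → (u Fin.<? v) ×-dec adj? u v)
                    (List.cartesianProduct (List.allFin n) (List.allFin n)))

  Adj⇒Linked : ∀ {u v} → Adj u v → Linked (edges G) u v
  Adj⇒Linked {u} {v} uv with Fin.<-cmp u v
  ... | tri< u<v u≢v _ = _ , ∈-filter⁺ _ (∈-cartesianProduct⁺ (∈-allFin u) (∈-allFin v)) (u<v , uv) , forth u≢v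
  ... | tri≈ _ u≡v _   = contradiction uv (irrefl u≡v)
  ... | tri> _ u≢v v<u = _ , ∈-filter⁺ _ (∈-cartesianProduct⁺ (∈-allFin v) (∈-allFin u)) (v<u , symm uv) , back u≢v

  signing : ∀ {fs} → fs ↭ edges G → ∀ s → ∃ λ (f : Signing G) →
    (∀ v → weight G f (incidentEdges G v) ≡ charge (incident v) (alternate s fs)) ×
    totalWeight G f ≡ charge (λ _ → true) (alternate s fs)
  signing σ s with f , f≡ ← distribute σ s =
    f , (λ v → trans (sum-cong-≗ λ e → cong (λ b → if b then f e ◃ 1 else 0ℤ)
                                            (Vec.lookup∘tabulate _ e))
                     (f≡ (incident v)))
      , trans (sum-cong-≗ λ e → cong (λ b → if b then f e ◃ 1 else 0ℤ)
                                     (Vec.lookup-replicate e true))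
              (f≡ (λ _ → true))

  lightSigning : Reduced (edges G) → ∃ λ (f : Signing G) →
    (∀ v → Light G f v) × -1ℤ ℤ.≤ totalWeight G f
  lightSigning r
    with fs , σ , bound ← negative-light r
    with f , f≡ , total ← signing σ Sign.- =
    f , (λ v → subst (ℤ._≤ 1ℤ) (sym (f≡ v)) (bound v))
      , subst (-1ℤ ℤ.≤_) (sym total) total≥-1
    where
    total≥-1 : -1ℤ ℤ.≤ charge (λ _ → true) (alternate Sign.- fs)
    total≥-1 with total-alternate Sign.- fs
    ... | inj₁ eq = subst (-1ℤ ℤ.≤_) (sym eq) ℤ.-≤+
    ... | inj₂ eq = subst (-1ℤ ℤ.≤_) (sym eq) ℤ.≤-refl

  nearlyLightSigning : Fin n → Reduced (edges G) → ∃ λ (f : Signing G) →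
    (∃ λ x → ∀ v → v ≢ x → Light G f v) × 0ℤ ℤ.≤ totalWeight G f
  nearlyLightSigning x₀ r
    with fs , σ , x , bound ← positive-light x₀ r
    with f , f≡ , total ← signing σ Sign.+ =
    f , (x , λ v v≢x → subst (ℤ._≤ 1ℤ) (sym (f≡ v)) (bound v v≢x))
      , subst (0ℤ ℤ.≤_) (sym total) total≥0
    where
    total≥0 : 0ℤ ℤ.≤ charge (λ _ → true) (alternate Sign.+ fs)
    total≥0 with total-alternate Sign.+ fs
    ... | inj₁ eq = subst (0ℤ ℤ.≤_) (sym eq) ℤ.≤-refl
    ... | inj₂ eq = subst (0ℤ ℤ.≤_) (sym eq) (ℤ.+≤+ ℕ.z≤n)

  -- Changing one sign from - to +.

  raise : Signing G → Edge G → Signing G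
  raise f e e′ = if does (e′ ≟ e) then Sign.+ else f e′

  weight-raise-∉ : ∀ f e S → lookup S e ≡ false → weight G (raise f e) S ≡ weight G f S
  weight-raise-∉ f e S e∉S = sum-cong-≗ term
    where
    term : ∀ e′ → (if lookup S e′ then raise f e e′ ◃ 1 else 0ℤ) ≡ (if lookup S e′ then f e′ ◃ 1 else 0ℤ)
    term e′ with e′ ≟ e
    ... | no _     = refl
    ... | yes refl rewrite e∉S = refl

  total-raise : ∀ f e → f e ≡ Sign.- → totalWeight G (raise f e) ≡ + 2 ℤ.+ totalWeight G f
  total-raise f e fe = begin
    totalWeight G (raise f e)             ≡⟨ total≡ (raise f e) ⟩
    sum (λ e′ → raise f e e′ ◃ 1)         ≡⟨ sum-raise f e fe ⟩
    + 2 ℤ.+ sum (λ e′ → f e′ ◃ 1)         ≡⟨ +-congˡ (+ 2) (total≡ f) ⟨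
    + 2 ℤ.+ totalWeight G f               ∎
    where
    open ≡-Reasoning
    total≡ : ∀ g → totalWeight G g ≡ sum (λ e′ → g e′ ◃ 1)
    total≡ g = sum-cong-≗ λ e′ → cong (λ b → if b then g e′ ◃ 1 else 0ℤ) (Vec.lookup-replicate e′ true)

    sum-raise : ∀ {m} (f : Fin m → Sign) e → f e ≡ Sign.- →
      sum (λ e′ → (if does (e′ ≟ e) then Sign.+ else f e′) ◃ 1) ≡ + 2 ℤ.+ sum (λ e′ → f e′ ◃ 1)
    -- The new term 1 is read as `+ 2 ℤ.+ -1ℤ`, to which it is equal by computation.
    sum-raise f zero fe rewrite fe = ℤ.+-assoc (+ 2) -1ℤ (sum (λ e′ → f (suc e′) ◃ 1))
    sum-raise f (suc e) fe = begin
      (f zero ◃ 1) ℤ.+ _                       ≡⟨ +-congˡ (f zero ◃ 1) (sum-raise (f ∘ suc) e fe) ⟩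
      (f zero ◃ 1) ℤ.+ (+ 2 ℤ.+ rest)          ≡⟨ ℤ.+-assoc (f zero ◃ 1) (+ 2) rest ⟨
      (f zero ◃ 1) ℤ.+ + 2 ℤ.+ rest            ≡⟨ cong (ℤ._+ rest) (ℤ.+-comm (f zero ◃ 1) (+ 2)) ⟩
      + 2 ℤ.+ (f zero ◃ 1) ℤ.+ rest            ≡⟨ ℤ.+-assoc (+ 2) (f zero ◃ 1) rest ⟩
      + 2 ℤ.+ ((f zero ◃ 1) ℤ.+ rest)          ∎
      where rest = sum (λ e′ → f (suc e′) ◃ 1)

  Light-raise : ∀ f e {v} → v ≢ proj₁ (endpoints G e) → v ≢ proj₂ (endpoints G e) →
    Light G f v → Light G (raise f e) v
  Light-raise f e {v} v≢a v≢b = subst (ℤ._≤ 1ℤ) (sym (weight-raise-∉ f e (incidentEdges G v) e∉))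
    where
    e∉ : lookup (incidentEdges G v) e ≡ false
    e∉ = trans (Vec.lookup∘tabulate _ e)
               (dec-false ((v ≟ proj₁ (endpoints G e)) ⊎-dec (v ≟ proj₂ (endpoints G e)))
                          λ { (inj₁ eq) → v≢a eq ; (inj₂ eq) → v≢b eq })

  -- Only the weights at the two ends of `e` change, so at most two vertices stop being light. They
  -- are discounted one at a time, with `away?` as the intermediate predicate that excludes the
  -- first end.
  raise-isSignedSubmatching : ∀ {k} f e →
    IsSignedSubmatching G (2 ℕ.+ k) f → IsSignedSubmatching G k (raise f e)
  raise-isSignedSubmatching f e many = ℕ.≤-pred (ℕ.≤-pred (ℕ.≤-trans many (ℕ.≤-trans
    (count-except (light? G f) away? a (λ v≢a l → v≢a , l))
    (ℕ.s≤s (count-except away? (light? G (raise f e)) b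
      (λ v≢b (v≢a , l) → Light-raise f e v≢a v≢b l))))))
    where
    a b : Fin n
    a = proj₁ (endpoints G e)
    b = proj₂ (endpoints G e)

    away? : Unary.Decidable (λ v → v ≢ a × Light G f v)
    away? v = ¬? (v ≟ a) ×-dec light? G f v

  total-positive : ∀ f → (∀ e → f e ≡ Sign.+) → totalWeight G f ≡ + size G
  total-positive f f≡+ = trans
    (sum-cong-≗ λ e → cong₂ (λ b s → if b then s ◃ 1 else 0ℤ) (Vec.lookup-replicate e true) (f≡+ e))
    (sum-ones (size G))
    where
    sum-ones : ∀ m → sum {m} (λ _ → 1ℤ) ≡ + m
    sum-ones ℕ.zero    = refl
    sum-ones (ℕ.suc m) = +-congˡ 1ℤ (sum-ones m)

  -- Descent on k in steps of 2.

  Heavy : ℕ → Set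
  Heavy k = ∃ λ f → IsSignedSubmatching G k f × + n ℤ.≤ + ℕ.suc k ℤ.+ totalWeight G f

  all-light : ∀ f → (∀ v → Light G f v) → IsSignedSubmatching G n f
  all-light f light = ℕ.≤-reflexive (sym (count-all (light? G f) light (Vec.allFin n)))

  light-except : ∀ {k} f x → ℕ.suc k ≡ n → (∀ v → v ≢ x → Light G f v) → IsSignedSubmatching G k f
  light-except f x refl light = ℕ.≤-pred (ℕ.≤-trans
    (ℕ.≤-reflexive (sym (count-all U? (λ _ → _) (Vec.allFin n))))
    (count-except U? (light? G f) x (λ {v} v≢x _ → light v v≢x)))

  Heavy-n : Reduced (edges G) → Heavy n
  Heavy-n r = let f , light , total = lightSigning r
              -- `+ ℕ.suc n ℤ.+ -1ℤ` computes to `+ n`, so a total of at least -1 is exactly what is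
              -- required.
              in f , all-light f light , ℤ.+-monoʳ-≤ (+ ℕ.suc n) total

  Heavy-n∸1 : ∀ {k} → ℕ.suc k ≡ n → Fin n → Reduced (edges G) → Heavy k
  Heavy-n∸1 {k} eq x r =
    let f , (y , light) , total = nearlyLightSigning x r
    in f , light-except f y eq light
         , subst (λ i → + i ℤ.≤ + ℕ.suc k ℤ.+ totalWeight G f) eq
             (subst (λ i → i ℤ.≤ + ℕ.suc k ℤ.+ totalWeight G f) (ℤ.+-identityʳ (+ ℕ.suc k))
               (ℤ.+-monoʳ-≤ (+ ℕ.suc k) total))

  -- Lowering `k` by 2 asks for 2 more in total weight, which raising a - supplies. Without any -
  -- the same `f` serves, because its total `size G` meets the bound for every `k`.
  Heavy-step : (∀ u v → Star (Linked (edges G)) u v) → ∀ {k} → Heavy (2 ℕ.+ k) → Heavy k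
  Heavy-step linked {k} (f , many , total) = byCases (Fin.any? (λ e → f e Sign.≟ Sign.-))
    where
    regroup : ∀ k t → + 3 ℤ.+ k ℤ.+ t ≡ 1ℤ ℤ.+ k ℤ.+ (+ 2 ℤ.+ t)
    regroup = solve-∀

    ≢-⇒+ : ∀ s → s ≢ Sign.- → s ≡ Sign.+
    ≢-⇒+ Sign.+ _   = refl
    ≢-⇒+ Sign.- s≢- = contradiction refl s≢-

    byCases : Dec (∃ λ e → f e ≡ Sign.-) → Heavy k
    byCases (yes (e , fe)) = raise f e , raise-isSignedSubmatching f e many ,
      ℤ.≤-trans total (ℤ.≤-reflexive (trans (regroup (+ k) (totalWeight G f))
        (+-congˡ (+ ℕ.suc k) (sym (total-raise f e fe)))))
    byCases (no none) = f , ℕ.≤-trans (ℕ.m≤n+m k 2) many ,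
      subst (λ t → + n ℤ.≤ + ℕ.suc k ℤ.+ t)
        (sym (total-positive f (λ e → ≢-⇒+ (f e) (λ fe → none (e , fe)))))
        (ℤ.+≤+ (ℕ.≤-trans (connected⇒n≤1+size (edges G) linked) (ℕ.s≤s (ℕ.m≤n+m (size G) k))))

  -- Here `j` is n - k, and its parity selects the base case, k = n or k = n - 1.
  heavy : Connected G → Fin n → ∀ j {k} → j ℕ.+ k ≡ n → Heavy k
  heavy connected x = descend
    where
    linked : ∀ u v → Star (Linked (edges G)) u v
    linked u v = Star.map Adj⇒Linked (connected u v)

    descend : ∀ j {k} → j ℕ.+ k ≡ n → Heavy k
    descend 0 eq = subst Heavy (sym eq) (Heavy-n (reduced linked edges-loopless))
    descend 1 eq = Heavy-n∸1 eq x (reduced linked edges-loopless)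
    descend (ℕ.suc (ℕ.suc j)) {k} eq = Heavy-step linked (descend j
      (trans (ℕ.+-suc j (ℕ.suc k)) (trans (cong ℕ.suc (ℕ.+-suc j k)) eq)))

theorem1 : ∀ {n : ℕ} (G : SimpleGraph n) → Connected G →
    ∀ (k : ℕ) → 1 ≤ℕ k → k ≤ℕ n →
    signedSubmatchingNumber G k ≥ + n - + k - 1ℤ
theorem1 {n} G connected k 1≤k k≤n =
  -- From 1 ≤ k ≤ n comes 0 < n, hence vertex 0 as the element of `Fin n`.
  let f , many , total = heavy G connected (fromℕ< (ℕ.≤-trans 1≤k k≤n)) (n ℕ.∸ k) (ℕ.m∸n+n≡m k≤n)
  in begin
    + n - + k - 1ℤ                            ≤⟨ ℤ.+-monoˡ-≤ -1ℤ (ℤ.+-monoˡ-≤ (ℤ.- + k) total) ⟩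
    + ℕ.suc k ℤ.+ totalWeight G f - + k - 1ℤ  ≡⟨ cancel (+ k) (totalWeight G f) ⟩
    totalWeight G f                           ≤⟨ totalWeight≤signedSubmatchingNumber G f many ⟩
    signedSubmatchingNumber G k               ∎
  where
  open ℤ.≤-Reasoning
  cancel : ∀ k t → 1ℤ ℤ.+ k ℤ.+ t - k - 1ℤ ≡ t
  cancel = solve-∀
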